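{- Suppose $0<1/n \ll \epsilon \ll d\leq 1$. Let $G[U,W]$ be an $(\epsilon,d)$-super-regular bipartite graph with $|U|=|W|=n$. Then for every edge $e\in E(G)$, $$\frac{|M_e(G)|}{|M(G)|} = (1\pm \epsilon^{1/20}) \frac{1}{dn}. $$ In other words, if we choose a perfect matching $\sigma$ of $G$ uniformly at random, then for any edge $uv\in E(G)$ with $u\in U$ and $v\in W$, $\mathbb{P}[ \sigma(u)=v ] = (1\pm \epsilon^{1/20}) \frac{1}{dn}.$
   Context: $M(G)$ denotes the set of perfect matchings of $G$ and $M_e(G)$ the set of perfect matchings containing the edge $e$; a perfect matching $\sigma$ is viewed as a bijection $U\to W$. Hierarchy convention: a statement holding whenever $0<1/n\ll a\ll b\le 1$ means there are non-decreasing functions such that it holds whenever each constant is at most the appropriate function of the constants to its right. A bipartite graph $G$ with classes $U,W$ is $(\epsilon,d)$-regular if for all $U'\subseteq U$, $W'\subseteq W$ with $|U'|>\epsilon|U|$, $|W'|>\epsilon|W|$ we have $e(G[U',W'])/(|U'||W'|)=d\pm\epsilon$; it is $(\epsilon,d)$-super-regular if moreover every vertex of $U$ has degree $(d\pm\epsilon)|W|$ and every vertex of $W$ has degree $(d\pm\epsilon)|U|$. Here $a=b\pm c$ means $b-c\le a\le b+c$.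
   Formalization: The constants ε and d, and the threshold functions of the hierarchy, are rational instead of real; the error ε^{1/20} is expressed by asserting the bound for every rational δ ≥ 0 with δ^20 ≥ ε. -}

module Defs where

open import Data.Nat as ℕ using (ℕ; zero; suc)
open import Data.Integer using (+_)
open import Data.Rational using (ℚ; _/_; _*_; _+_; _-_; _≤_; _<_; 0ℚ; 1ℚ)
open import Data.Bool using (Bool; true; false; _∧_; _∨_; not; if_then_else_)
open import Data.Fin using (Fin; zero; suc)
open import Data.Fin.Properties using (_≟_)
open import Data.Vec using (Vec; []; _∷_; lookup)
open import Data.List using (List; []; _∷_; concatMap; map; filterᵇ; length)
open import Data.List using (allFin)
open import Data.Nat.ListAction renaming (sum to lsum)
open import Data.Bool.ListAction using (and)
open import Relation.Nullary.Decidable using (⌊_⌋)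
open import Data.Product using (_×_)

ℕ→ℚ : ℕ → ℚ
ℕ→ℚ k = + k / 1

_^_ : ℚ → ℕ → ℚ
x ^ zero = 1ℚ
x ^ suc k = x * (x ^ k)

infix 4 _≐_±_
_≐_±_ : ℚ → ℚ → ℚ → Set
x ≐ y ± c = (y - c ≤ x) × (x ≤ y + c)

-- A bipartite graph G[U,W] with U = W = Fin n (as two disjoint copies),
-- given by its (decidable) adjacency: E u w = true iff uw is an edge.
BipGraph : ℕ → Set
BipGraph n = Fin n → Fin n → Bool

Sub : ℕ → Set
Sub n = Fin n → Bool

count : ∀ {n} → (Fin n → Bool) → ℕ
count {n} P = length (filterᵇ P (allFin n))

eG : ∀ {n} → BipGraph n → Sub n → Sub n → ℕ
eG {n} E U' W' = lsum (map (λ u → count (λ w → U' u ∧ W' w ∧ E u w)) (allFin n))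

degU : ∀ {n} → BipGraph n → Fin n → ℕ
degU E u = count (λ w → E u w)

degW : ∀ {n} → BipGraph n → Fin n → ℕ
degW E w = count (λ u → E u w)

-- (ε,d)-regular, with the density condition e/(|U'||W'|) = d ± ε
-- written multiplied out by |U'||W'| > 0.
Regular : ∀ {n} → ℚ → ℚ → BipGraph n → Set
Regular {n} ε d E =
  (U' W' : Sub n) →
  ε * ℕ→ℚ n < ℕ→ℚ (count U') → ε * ℕ→ℚ n < ℕ→ℚ (count W') →
  ℕ→ℚ (eG E U' W') ≐ d * ℕ→ℚ (count U' ℕ.* count W') ± (ε * ℕ→ℚ (count U' ℕ.* count W'))

SuperRegular : ∀ {n} → ℚ → ℚ → BipGraph n → Set
SuperRegular {n} ε d E =
  Regular ε d E
  × ((u : Fin n) → ℕ→ℚ (degU E u) ≐ d * ℕ→ℚ n ± (ε * ℕ→ℚ n))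
  × ((w : Fin n) → ℕ→ℚ (degW E w) ≐ d * ℕ→ℚ n ± (ε * ℕ→ℚ n))

allVecs : (n k : ℕ) → List (Vec (Fin n) k)
allVecs n zero = [] ∷ []
allVecs n (suc k) = concatMap (λ v → map (λ i → i ∷ v) (allFin n)) (allVecs n k)

_==_ : ∀ {n} → Fin n → Fin n → Bool
i == j = ⌊ i ≟ j ⌋

allᵇ : ∀ {n} → (Fin n → Bool) → Bool
allᵇ {n} P = and (map P (allFin n))

-- σ : U → W is a perfect matching of G: injective (hence bijective) and
-- every pair u σ(u) is an edge.
isPM : ∀ {n} → BipGraph n → Vec (Fin n) n → Bool
isPM E σ = allᵇ (λ u → E u (lookup σ u))
         ∧ allᵇ (λ i → allᵇ (λ j → (i == j) ∨ not (lookup σ i == lookup σ j)))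

numPM : ∀ {n} → BipGraph n → ℕ
numPM {n} E = length (filterᵇ (isPM E) (allVecs n n))

numPMe : ∀ {n} → BipGraph n → Fin n → Fin n → ℕ
numPMe {n} E u w = length (filterᵇ (λ σ → isPM E σ ∧ (lookup σ u == w)) (allVecs n n))

Mono₁ : (ℚ → ℚ) → Set
Mono₁ f = ∀ x y → 0ℚ < x → x ≤ y → f x ≤ f y

Mono₂ : (ℚ → ℚ → ℚ) → Set
Mono₂ f = ∀ x x' y y' → 0ℚ < x → 0ℚ < y → x ≤ x' → y ≤ y' → f x y ≤ f x' y'

{-# OPTIONS --safe #-}
-- Fix u and two neighbours w, w′. A perfect matching σ with σ(u) = w is turned into one with
-- σ(u) = w′ by rotating σ along four vertices u, a, b, c with σ(c) = w′, where a w, b σ(a) and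
-- c σ(b) are edges. The sets σ(N(w)) and σ⁻¹(N(c)) have size about dn, so regularity gives
-- (d ± ε)³n² choices of (a , b), up to the at most 5n choices where the vertices collide; the same
-- count bounds the number of ways in which a matching through u w′ arises. Hence all edges at u
-- lie in almost the same number of perfect matchings, and there are (d ± ε)n of them.
-- The same walks yield a perfect matching: starting from any permutation, a vertex x whose pair
-- x f(x) is not an edge is repaired by a rotation after which every y that was matched along an
-- edge still is.
module Submission where

open import Defs
open import Data.Nat using (ℕ; suc)
open import Data.Rational using (ℚ; _≤_; _<_; _*_; _+_; _-_; 0ℚ; 1ℚ)
open import Data.Product using (Σ; _×_)
open import Data.Bool using (true)
open import Data.Fin using (Fin)
open import Relation.Binary.PropositionalEquality using (_≡_)

open import Data.Bool using (Bool; false; T; T?; _∧_; _∨_; not)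
open import Data.Bool.Properties using (T-∧; T-∨; T-≡)
open import Data.Empty using (⊥)
open import Data.Fin using (punchOut)
open import Data.Fin.Permutation.Components using (transpose; transpose-inverse)
open import Data.Fin.Properties using (_≟_; any?; injective⇒≤; punchOut-injective)
open import Data.Integer as ℤ using (+_)
import Data.Integer.Properties as ℤₚ
open import Data.List using (List; []; _∷_; _++_; map; length; filterᵇ; allFin; concatMap; cartesianProduct; cartesianProductWith)
open import Data.List.Membership.Propositional using (_∈_)
open import Data.List.Membership.Propositional.Properties
open import Data.List.Properties using (length-++; filter-++; length-tabulate)
open import Data.List.Relation.Unary.All as All using (All; []; _∷_)
import Data.List.Relation.Unary.All.Properties as All
open import Data.List.Relation.Unary.AllPairs using ([]; _∷_)
open import Data.List.Relation.Unary.Any using (here; there)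
open import Data.List.Relation.Unary.Unique.Propositional using (Unique)
import Data.List.Relation.Unary.Unique.Propositional.Properties as Unique
import Data.Nat as ℕ
open import Data.Nat using (zero)
open import Data.Nat.ListAction renaming (sum to lsum)
import Data.Nat.Properties as ℕₚ
open import Data.Product using (∃; _,_; proj₁; proj₂)
open import Data.Rational using (_/_; -_; toℚᵘ; Positive; positive; nonNegative)
open import Data.Rational.Properties hiding (_≟_)
open import Data.Rational.Solver
import Data.Rational.Unnormalised as ℚᵘ
import Data.Rational.Unnormalised.Properties as ℚᵘₚ
open import Data.Sum using (inj₁; inj₂)
open import Data.Unit using (tt)
open import Data.Vec using (Vec; []; _∷_; lookup; tabulate)
import Data.Vec.Properties as Vec
open import Function.Base using (_∘_; id)
open import Function.Bundles using (Equivalence)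
open import Function.Definitions using (Injective)
open import Relation.Binary.PropositionalEquality hiding (_≡_; [_])
open import Relation.Nullary using (¬_; Dec; yes; no; contradiction)
open import Relation.Nullary.Decidable using (toWitness; fromWitness; dec-true; dec-false)
open +-*-Solver using (Polynomial; solve; _:=_; _:+_; _:*_; _:-_; con)

-- Rational arithmetic

toℚᵘ-ℕ→ℚ : ∀ k → toℚᵘ (ℕ→ℚ k) ℚᵘ.≃ ℚᵘ.mkℚᵘ (+ k) 0
toℚᵘ-ℕ→ℚ k = toℚᵘ-fromℚᵘ (ℚᵘ.mkℚᵘ (+ k) 0)

ℕ→ℚ-+ : ∀ a b → ℕ→ℚ (a ℕ.+ b) ≡ ℕ→ℚ a + ℕ→ℚ b
ℕ→ℚ-+ a b = toℚᵘ-injective (begin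
  toℚᵘ (ℕ→ℚ (a ℕ.+ b))                    ≈⟨ toℚᵘ-ℕ→ℚ (a ℕ.+ b) ⟩
  ℚᵘ.mkℚᵘ (+ (a ℕ.+ b)) 0                 ≈⟨ ℚᵘ.*≡* (cong (ℤ._* + 1) (cong₂ ℤ._+_ (sym (ℤₚ.*-identityʳ (+ a))) (sym (ℤₚ.*-identityʳ (+ b))))) ⟩
  ℚᵘ.mkℚᵘ (+ a) 0 ℚᵘ.+ ℚᵘ.mkℚᵘ (+ b) 0    ≈⟨ ℚᵘₚ.+-cong (toℚᵘ-ℕ→ℚ a) (toℚᵘ-ℕ→ℚ b) ⟨
  toℚᵘ (ℕ→ℚ a) ℚᵘ.+ toℚᵘ (ℕ→ℚ b)          ≈⟨ toℚᵘ-homo-+ (ℕ→ℚ a) (ℕ→ℚ b) ⟨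
  toℚᵘ (ℕ→ℚ a + ℕ→ℚ b)                    ∎)
  where open ℚᵘₚ.≃-Reasoning

ℕ→ℚ-* : ∀ a b → ℕ→ℚ (a ℕ.* b) ≡ ℕ→ℚ a * ℕ→ℚ b
ℕ→ℚ-* a b = toℚᵘ-injective (begin
  toℚᵘ (ℕ→ℚ (a ℕ.* b))                    ≈⟨ toℚᵘ-ℕ→ℚ (a ℕ.* b) ⟩
  ℚᵘ.mkℚᵘ (+ (a ℕ.* b)) 0                 ≈⟨ ℚᵘ.*≡* (cong (ℤ._* + 1) (ℤₚ.pos-* a b)) ⟩
  ℚᵘ.mkℚᵘ (+ a) 0 ℚᵘ.* ℚᵘ.mkℚᵘ (+ b) 0    ≈⟨ ℚᵘₚ.*-cong (toℚᵘ-ℕ→ℚ a) (toℚᵘ-ℕ→ℚ b) ⟨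
  toℚᵘ (ℕ→ℚ a) ℚᵘ.* toℚᵘ (ℕ→ℚ b)          ≈⟨ toℚᵘ-homo-* (ℕ→ℚ a) (ℕ→ℚ b) ⟨
  toℚᵘ (ℕ→ℚ a * ℕ→ℚ b)                    ∎)
  where open ℚᵘₚ.≃-Reasoning

0≤ℕ→ℚ : ∀ k → 0ℚ ≤ ℕ→ℚ k
0≤ℕ→ℚ k = nonNegative⁻¹ (ℕ→ℚ k) {{normalize-nonNeg k 1}}

ℕ→ℚ-mono-≤ : ∀ a b → a ℕ.≤ b → ℕ→ℚ a ≤ ℕ→ℚ b
ℕ→ℚ-mono-≤ a b a≤b = subst₂ _≤_ (+-identityʳ (ℕ→ℚ a))
  (trans (sym (ℕ→ℚ-+ a (b ℕ.∸ a))) (cong ℕ→ℚ (ℕₚ.m+[n∸m]≡n a≤b)))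
  (+-monoʳ-≤ (ℕ→ℚ a) (0≤ℕ→ℚ (b ℕ.∸ a)))

0<ℕ→ℚ⇒0< : ∀ k → 0ℚ < ℕ→ℚ k → 0 ℕ.< k
0<ℕ→ℚ⇒0< zero    0<0 = contradiction 0<0 (<-irrefl refl)
0<ℕ→ℚ⇒0< (suc k) _   = ℕ.s≤s ℕ.z≤n

≤-+-nonneg : ∀ {p q r} → 0ℚ ≤ r → q ≡ p + r → p ≤ q
≤-+-nonneg {p} {r = r} 0≤r refl = subst (_≤ p + r) (+-identityʳ p) (+-monoʳ-≤ p 0≤r)

p≤q⇒0≤q-p : ∀ {p q} → p ≤ q → 0ℚ ≤ q - p
p≤q⇒0≤q-p {p} {q} p≤q = subst (_≤ q - p) (+-inverseʳ p) (+-monoˡ-≤ (- p) p≤q)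

0≤-+ : ∀ {p q} → 0ℚ ≤ p → 0ℚ ≤ q → 0ℚ ≤ p + q
0≤-+ = +-mono-≤

*-mono-≤ : ∀ {p q r s} → 0ℚ ≤ q → 0ℚ ≤ r → p ≤ q → r ≤ s → p * r ≤ q * s
*-mono-≤ {p} {q} {r} 0≤q 0≤r p≤q r≤s =
  ≤-trans (*-monoʳ-≤-nonNeg r {{nonNegative 0≤r}} p≤q) (*-monoˡ-≤-nonNeg q {{nonNegative 0≤q}} r≤s)

0≤-* : ∀ {p q} → 0ℚ ≤ p → 0ℚ ≤ q → 0ℚ ≤ p * q
0≤-* 0≤p 0≤q = *-mono-≤ 0≤p ≤-refl 0≤p 0≤q

0<-* : ∀ {p q} → 0ℚ < p → 0ℚ < q → 0ℚ < p * q
0<-* {p} {q} 0<p 0<q = positive⁻¹ (p * q) {{pos*pos⇒pos p {{positive 0<p}} q {{positive 0<q}}}}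

*-cancelʳ-≤ : ∀ {p q r} → 0ℚ < r → p * r ≤ q * r → p ≤ q
*-cancelʳ-≤ {r = r} 0<r = *-cancelʳ-≤-pos r {{positive 0<r}}

+-cancelʳ-≤ : ∀ {p q} r → p + r ≤ q + r → p ≤ q
+-cancelʳ-≤ {p} {q} r h = subst₂ _≤_ (cancel p) (cancel q) (+-monoˡ-≤ (- r) h)
  where
  cancel : ∀ x → x + r - r ≡ x
  cancel x = solve 2 (λ x r → x :+ r :- r := x) refl x r

-- The end of the double count: `X` and `Y` are the total numbers of choices, `K` the common factor
-- `d²n²` of the counts per matching. The factors `1ℚ` give the hypotheses the shape that
-- `sum-lower` and `sum-upper` deliver at `r = 1ℚ`.
ratio-from-totals : ∀ A A′ X Y a b K → 0ℚ < K → a * K * A ≤ 1ℚ * X → X ≤ Y → 1ℚ * Y ≤ b * K * A′ → A * a ≤ A′ * b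
ratio-from-totals A A′ X Y a b K 0<K h₁ h₂ h₃ = *-cancelʳ-≤ 0<K
  (subst₂ _≤_ (rearrange a A) (rearrange b A′) (≤-trans h₁ (≤-trans (*-monoˡ-≤-nonNeg 1ℚ h₂) h₃)))
  where
  rearrange : ∀ x y → x * K * y ≡ y * x * K
  rearrange x y = solve 3 (λ x y K → x :* K :* y := y :* x :* K) refl x y K

module _ {A : Set} (f : A → ℕ) (q r : ℚ) where

  private
    r-distrib : ∀ a b → r * ℕ→ℚ (a ℕ.+ b) ≡ r * ℕ→ℚ a + r * ℕ→ℚ b
    r-distrib a b = trans (cong (r *_) (ℕ→ℚ-+ a b)) (*-distribˡ-+ r _ _)

    q-distrib : ∀ k → q * ℕ→ℚ (suc k) ≡ q + q * ℕ→ℚ k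
    q-distrib k = trans (cong (q *_) (ℕ→ℚ-+ 1 k))
      (trans (*-distribˡ-+ q _ _) (cong (_+ q * ℕ→ℚ k) (*-identityʳ q)))

  -- k and l are tied to the list by equations because conversion checking would otherwise compare
  -- their images under ℕ→ℚ by unfolding the gcd.
  sum-lower : ∀ xs k l → length xs ≡ k → lsum (map f xs) ≡ l → (∀ x → x ∈ xs → q ≤ r * ℕ→ℚ (f x)) →
              q * ℕ→ℚ k ≤ r * ℕ→ℚ l
  sum-lower []       _ _ refl refl h = ≤-reflexive (trans (*-zeroʳ q) (sym (*-zeroʳ r)))
  sum-lower (x ∷ xs) _ _ refl refl h = subst₂ _≤_ (sym (q-distrib (length xs))) (sym (r-distrib (f x) _))
    (+-mono-≤ (h x (here refl)) (sum-lower xs _ _ refl refl λ y y∈ → h y (there y∈)))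

  sum-upper : ∀ xs k l → length xs ≡ k → lsum (map f xs) ≡ l → (∀ x → x ∈ xs → r * ℕ→ℚ (f x) ≤ q) →
              r * ℕ→ℚ l ≤ q * ℕ→ℚ k
  sum-upper []       _ _ refl refl h = ≤-reflexive (trans (*-zeroʳ r) (sym (*-zeroʳ q)))
  sum-upper (x ∷ xs) _ _ refl refl h = subst₂ _≤_ (sym (r-distrib (f x) _)) (sym (q-distrib (length xs)))
    (+-mono-≤ (h x (here refl)) (sum-upper xs _ _ refl refl λ y y∈ → h y (there y∈)))

-- Estimates under the hierarchy 1/n ≪ ε ≪ d

lit : ∀ {m} → ℕ → Polynomial m
lit k = con (ℕ→ℚ k)

-- The constant 600 exceeds 24² = 576, which is what `24ε≤δd` needs; together with `d ≤ 1` it also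
-- gives `24 ε ≤ d`.
ε-bound : ℚ → ℚ
ε-bound d = d * d * (+ 1 / 600)

-- Chosen so that `1 ≤ ν n` says `5 n ≤ ε d² n²`: the at most `5 n` colliding choices cost one
-- further `ε` in the density.
ν-bound : ℚ → ℚ → ℚ
ν-bound ε d = ε * (d * d) * (+ 1 / 5)

ε-bound-mono : Mono₁ ε-bound
ε-bound-mono x y 0<x x≤y = *-monoʳ-≤-nonNeg (+ 1 / 600) (*-mono-≤ 0≤y (<⇒≤ 0<x) x≤y x≤y)
  where 0≤y = ≤-trans (<⇒≤ 0<x) x≤y

ν-bound-mono : Mono₂ ν-bound
ν-bound-mono x x' y y' 0<x 0<y x≤x' y≤y' =
  *-monoʳ-≤-nonNeg (+ 1 / 5) (*-mono-≤ (≤-trans (<⇒≤ 0<x) x≤x') (0≤-* (<⇒≤ 0<y) (<⇒≤ 0<y)) x≤x'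
    (*-mono-≤ (≤-trans (<⇒≤ 0<y) y≤y') (<⇒≤ 0<y) y≤y' y≤y'))

ε-bound-pos : ∀ d → 0ℚ < d → 0ℚ < ε-bound d
ε-bound-pos d 0<d = 0<-* (0<-* 0<d 0<d) (positive⁻¹ (+ 1 / 600))

ν-bound-pos : ∀ ε d → 0ℚ < ε → 0ℚ < d → 0ℚ < ν-bound ε d
ν-bound-pos ε d 0<ε 0<d = 0<-* (0<-* 0<ε (0<-* 0<d 0<d)) (positive⁻¹ (+ 1 / 5))

0≤^ : ∀ {δ} k → 0ℚ ≤ δ → 0ℚ ≤ δ ^ k
0≤^ zero    0≤δ = nonNegative⁻¹ 1ℚ
0≤^ (suc k) 0≤δ = 0≤-* 0≤δ (0≤^ k 0≤δ)

^-≤1 : ∀ {δ} k → 0ℚ ≤ δ → δ ≤ 1ℚ → δ ^ k ≤ 1ℚ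
^-≤1 zero    0≤δ δ≤1 = ≤-refl
^-≤1 {δ} (suc k) 0≤δ δ≤1 =
  ≤-trans (*-mono-≤ (nonNegative⁻¹ 1ℚ) (0≤^ k 0≤δ) δ≤1 (^-≤1 k 0≤δ δ≤1)) (≤-reflexive (*-identityˡ 1ℚ))

module _ {d ε : ℚ} (0<d : 0ℚ < d) (d≤1 : d ≤ 1ℚ) (0<ε : 0ℚ < ε) (ε≤ : ε ≤ ε-bound d) where

  private
    0≤d = <⇒≤ 0<d
    0≤ε = <⇒≤ 0<ε

  600ε≤d² : ℕ→ℚ 600 * ε ≤ d * d
  600ε≤d² = ≤-trans (*-monoˡ-≤-nonNeg (ℕ→ℚ 600) ε≤)
    (≤-reflexive (solve 1 (λ d → lit 600 :* (d :* d :* con (+ 1 / 600)) := d :* d) refl d))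

  d²≤d : d * d ≤ d
  d²≤d = ≤-trans (*-monoˡ-≤-nonNeg d {{nonNegative 0≤d}} d≤1) (≤-reflexive (*-identityʳ d))

  24ε≤d : ℕ→ℚ 24 * ε ≤ d
  24ε≤d = ≤-trans (≤-+-nonneg (0≤-* (0≤ℕ→ℚ 576) 0≤ε)
    (solve 1 (λ e → lit 600 :* e := lit 24 :* e :+ lit 576 :* e) refl ε)) (≤-trans 600ε≤d² d²≤d)

  -- The common source of signs: a difference `d - k ε` with k < 24 is treated as this one plus a
  -- multiple of `ε`.
  0≤d-24ε : 0ℚ ≤ d - ℕ→ℚ 24 * ε
  0≤d-24ε = p≤q⇒0≤q-p 24ε≤d

  -- If δ < 1 then (δ d)² ≥ ε d² ≥ 600 ε² > (24 ε)².
  24ε≤δd : ∀ {δ} → 0ℚ ≤ δ → ε ≤ δ ^ 20 → ℕ→ℚ 24 * ε ≤ δ * d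
  24ε≤δd {δ} 0≤δ ε≤δ²⁰ with ≤-total 1ℚ δ
  ... | inj₁ 1≤δ = ≤-trans 24ε≤d (≤-trans (≤-reflexive (sym (*-identityˡ d))) (*-monoʳ-≤-nonNeg d {{nonNegative 0≤d}} 1≤δ))
  ... | inj₂ δ≤1 with ℕ→ℚ 24 * ε ≤? δ * d
  ...   | yes le = le
  ...   | no ¬le = contradiction (<-≤-trans lt ge) (<-irrefl refl)
    where
    -- `δ ^ 20` unfolds to `δ * (δ * δ ^ 18)`, whose last factor is at most 1.
    ε≤δ² : ε ≤ δ * δ
    ε≤δ² = ≤-trans ε≤δ²⁰ (≤-trans
      (*-monoˡ-≤-nonNeg δ {{nonNegative 0≤δ}} (*-monoˡ-≤-nonNeg δ {{nonNegative 0≤δ}} (^-≤1 18 0≤δ δ≤1)))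
      (≤-reflexive (cong (δ *_) (*-identityʳ δ))))
    lt : δ * d * (δ * d) < ℕ→ℚ 24 * ε * (ℕ→ℚ 24 * ε)
    lt = ≤-<-trans (*-monoˡ-≤-nonNeg (δ * d) {{nonNegative (0≤-* 0≤δ 0≤d)}} (<⇒≤ (≰⇒> ¬le)))
           (*-monoˡ-<-pos (ℕ→ℚ 24 * ε) {{positive (0<-* (positive⁻¹ (ℕ→ℚ 24)) 0<ε)}} (≰⇒> ¬le))
    ge : ℕ→ℚ 24 * ε * (ℕ→ℚ 24 * ε) ≤ δ * d * (δ * d)
    ge = ≤-trans (≤-+-nonneg (0≤-* (0≤ℕ→ℚ 24) (0≤-* 0≤ε 0≤ε))
           (solve 1 (λ e → e :* (lit 600 :* e) := lit 24 :* e :* (lit 24 :* e) :+ lit 24 :* (e :* e)) refl ε))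
         (≤-trans (*-mono-≤ (0≤-* 0≤δ 0≤δ) (0≤-* (0≤ℕ→ℚ 600) 0≤ε) ε≤δ² 600ε≤d²)
           (≤-reflexive (solve 2 (λ s d → s :* s :* (d :* d) := s :* d :* (s :* d)) refl δ d)))

  0≤d-ε : 0ℚ ≤ d - ε
  0≤d-ε = subst (0ℚ ≤_) (solve 2 (λ d e → d :- lit 24 :* e :+ lit 23 :* e := d :- e) refl d ε)
    (0≤-+ 0≤d-24ε (0≤-* (0≤ℕ→ℚ 23) 0≤ε))

  module _ {N : ℚ} (0<N : 0ℚ < N) where

    private
      0≤N = <⇒≤ 0<N

    -- Sets as large as the minimum degree pass the size threshold of regularity, because `d - 3 ε`
    -- is nonnegative and `ε N` is positive.
    εN<lower : ε * N < d * N - ε * N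
    εN<lower = <-≤-trans
      (subst (_< ε * N + ε * N) (+-identityʳ (ε * N)) (+-monoʳ-< (ε * N) (0<-* 0<ε 0<N)))
      (≤-+-nonneg (0≤-* (0≤-+ 0≤d-24ε (0≤-* (0≤ℕ→ℚ 21) 0≤ε)) 0≤N)
        (solve 3 (λ d e N → d :* N :- e :* N := e :* N :+ e :* N :+ (d :- lit 24 :* e :+ lit 21 :* e) :* N) refl d ε N))

    -- Here `p` and `q` stand for the degrees of the two ends of a walk, and the right side is the
    -- bound that regularity gives.
    cube-lower : ∀ {p q} → d * N - ε * N ≤ p → d * N - ε * N ≤ q →
                 (d - ε) * ((d * N - ε * N) * (d * N - ε * N)) ≤ d * (p * q) - ε * (p * q)
    cube-lower {p} {q} l≤p l≤q = ≤-trans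
      (*-monoˡ-≤-nonNeg (d - ε) {{nonNegative 0≤d-ε}} (*-mono-≤ (≤-trans 0≤l l≤p) 0≤l l≤p l≤q))
      (≤-reflexive (solve 3 (λ d e x → (d :- e) :* x := d :* x :- e :* x) refl d ε (p * q)))
      where
      0≤l : 0ℚ ≤ d * N - ε * N
      0≤l = ≤-trans (0≤-* 0≤ε 0≤N) (<⇒≤ εN<lower)

    0<cube : 0ℚ < (d - ε) * ((d * N - ε * N) * (d * N - ε * N))
    0<cube = 0<-* 0<d-ε (0<-* 0<l 0<l)
      where
      0<l : 0ℚ < d * N - ε * N
      0<l = <-trans (0<-* 0<ε 0<N) εN<lower
      0<d-ε : 0ℚ < d - ε
      0<d-ε = <-≤-trans 0<ε (≤-+-nonneg (0≤-+ 0≤d-24ε (0≤-* (0≤ℕ→ℚ 22) 0≤ε))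
        (solve 2 (λ d e → d :- e := e :+ (d :- lit 24 :* e :+ lit 22 :* e)) refl d ε))

    -- As `ε ≤ d`, the error `3 d² ε + 3 d ε² + ε³` of `(d + ε)³` is at most `7 d² ε`, whence the
    -- constant 7.
    cube-upper : ∀ {p q} → 0ℚ ≤ p → 0ℚ ≤ q → p ≤ d * N + ε * N → q ≤ d * N + ε * N →
                 d * (p * q) + ε * (p * q) ≤ (d + ℕ→ℚ 7 * ε) * (d * d * (N * N))
    cube-upper {p} {q} 0≤p 0≤q p≤ q≤ = ≤-trans
      (≤-reflexive (sym (*-distribʳ-+ (p * q) d ε)))
      (≤-trans (*-monoˡ-≤-nonNeg (d + ε) {{nonNegative (0≤-+ 0≤d 0≤ε)}}
        (*-mono-≤ (≤-trans 0≤p p≤) 0≤q p≤ q≤))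
      (≤-+-nonneg (0≤-* (0≤-* (0≤-* 0≤ε 0≤d-ε) (0≤-+ (0≤-* (0≤ℕ→ℚ 4) 0≤d) 0≤ε)) (0≤-* 0≤N 0≤N))
        (solve 3 (λ d e N → (d :+ lit 7 :* e) :* (d :* d :* (N :* N)) :=
           (d :+ e) :* ((d :* N :+ e :* N) :* (d :* N :+ e :* N)) :+ e :* (d :- e) :* (lit 4 :* d :+ e) :* (N :* N)) refl d ε N)))

    -- Three of the four `ε` come from `(d - ε)³ ≥ d² (d - 3 ε)`; the fourth pays for `5 N` by the
    -- choice of `ν-bound`.
    cube-minus-5N : ℕ→ℚ 1 ≤ ν-bound ε d * N →
      (d - ℕ→ℚ 4 * ε) * (d * d * (N * N)) + ℕ→ℚ 5 * N ≤ (d - ε) * ((d * N - ε * N) * (d * N - ε * N))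
    cube-minus-5N 1≤νN = ≤-+-nonneg
      (0≤-+ (0≤-* (0≤-* (0≤-* 0≤ε 0≤ε) (0≤-+ 0≤d-ε (0≤-* (0≤ℕ→ℚ 2) 0≤d))) (0≤-* 0≤N 0≤N))
            (0≤-* 0≤N (0≤-* (0≤ℕ→ℚ 5) (p≤q⇒0≤q-p 1≤νN))))
      (solve 3 (λ d e N → (d :- e) :* ((d :* N :- e :* N) :* (d :* N :- e :* N)) :=
          (d :- lit 4 :* e) :* (d :* d :* (N :* N)) :+ lit 5 :* N
          :+ (e :* e :* (d :- e :+ lit 2 :* d) :* (N :* N)
              :+ N :* (lit 5 :* (e :* (d :* d) :* con (+ 1 / 5) :* N :- lit 1)))) refl d ε N)

    module _ {δ A M D : ℚ} (0≤δ : 0ℚ ≤ δ) (24ε≤δd : ℕ→ℚ 24 * ε ≤ δ * d) (0≤A : 0ℚ ≤ A) (0≤M : 0ℚ ≤ M) where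

      private
        0≤δd-24ε = p≤q⇒0≤q-p 24ε≤δd

      -- It suffices that `(1 - δ)(d + 7ε)(d + ε) ≤ d (d - 4ε)`. The deficit `12 d ε + 7 ε²` is at
      -- most `19 d ε`, hence below `δ d²`.
      edge-share-lower : (d - ℕ→ℚ 4 * ε) * M ≤ A * (d + ℕ→ℚ 7 * ε) * D → D ≤ d * N + ε * N →
                         M - δ * M ≤ A * d * N
      edge-share-lower h D≤ = *-cancelʳ-≤ (0<-* (+-mono-<-≤ 0<d (0≤-* (0≤ℕ→ℚ 7) 0≤ε)) (+-mono-<-≤ 0<d 0≤ε)) (begin
        (M - δ * M) * ((d + ℕ→ℚ 7 * ε) * (d + ε))
          ≤⟨ ≤-+-nonneg (0≤-* 0≤M (0≤-+ (0≤-+ (0≤-* 0≤d 0≤δd-24ε)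
               (0≤-* 0≤δ (0≤-+ (0≤-* (0≤-* (0≤ℕ→ℚ 8) 0≤d) 0≤ε) (0≤-* (0≤ℕ→ℚ 7) (0≤-* 0≤ε 0≤ε)))))
               (0≤-* 0≤ε (0≤-+ (0≤-* (0≤ℕ→ℚ 7) 0≤d-ε) (0≤-* (0≤ℕ→ℚ 5) 0≤d)))))
             (solve 4 (λ d e s M → d :* ((d :- lit 4 :* e) :* M) :=
               (M :- s :* M) :* ((d :+ lit 7 :* e) :* (d :+ e)) :+
               M :* (d :* (s :* d :- lit 24 :* e) :+ s :* (lit 8 :* d :* e :+ lit 7 :* (e :* e))
                 :+ e :* (lit 7 :* (d :- e) :+ lit 5 :* d))) refl d ε δ M) ⟩
        d * ((d - ℕ→ℚ 4 * ε) * M)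
          ≤⟨ *-monoˡ-≤-nonNeg d {{nonNegative 0≤d}} (≤-trans h
               (*-monoˡ-≤-nonNeg (A * (d + ℕ→ℚ 7 * ε)) {{nonNegative (0≤-* 0≤A (0≤-+ 0≤d (0≤-* (0≤ℕ→ℚ 7) 0≤ε)))}} D≤)) ⟩
        d * (A * (d + ℕ→ℚ 7 * ε) * (d * N + ε * N))
          ≡⟨ solve 4 (λ d e A N → d :* (A :* (d :+ lit 7 :* e) :* (d :* N :+ e :* N)) :=
               A :* d :* N :* ((d :+ lit 7 :* e) :* (d :+ e))) refl d ε A N ⟩
        A * d * N * ((d + ℕ→ℚ 7 * ε) * (d + ε)) ∎)
        where
        open ≤-Reasoning

      -- The cancelled factor is 2 (d − 4ε)(d − ε), written so that its positivity can be read off.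
      edge-share-upper : A * (d - ℕ→ℚ 4 * ε) * D ≤ (d + ℕ→ℚ 7 * ε) * M → d * N - ε * N ≤ D →
                         A * d * N ≤ M + δ * M
      edge-share-upper h ≤D = *-cancelʳ-≤ (0<-* (0<d-kε 20) (0<-* (0<d-kε 23) (positive⁻¹ (ℕ→ℚ 2)))) (begin
        A * d * N * ((ℕ→ℚ 20 * ε + (d - ℕ→ℚ 24 * ε)) * ((ℕ→ℚ 23 * ε + (d - ℕ→ℚ 24 * ε)) * ℕ→ℚ 2))
          ≡⟨ solve 4 (λ d e A N → A :* d :* N :* ((lit 20 :* e :+ (d :- lit 24 :* e)) :* ((lit 23 :* e :+ (d :- lit 24 :* e)) :* lit 2))
               := lit 2 :* d :* (A :* (d :- lit 4 :* e) :* (d :* N :- e :* N))) refl d ε A N ⟩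
        ℕ→ℚ 2 * d * (A * (d - ℕ→ℚ 4 * ε) * (d * N - ε * N))
          ≤⟨ *-monoˡ-≤-nonNeg (ℕ→ℚ 2 * d) {{nonNegative (0≤-* (0≤ℕ→ℚ 2) 0≤d)}} (≤-trans
               (*-monoˡ-≤-nonNeg (A * (d - ℕ→ℚ 4 * ε)) {{nonNegative (0≤-* 0≤A 0≤d-4ε)}} ≤D) h) ⟩
        ℕ→ℚ 2 * d * ((d + ℕ→ℚ 7 * ε) * M)
          -- The origin of 24: `2 d (d + 7ε)` exceeds `2 (d - 4ε)(d - ε)` by `24 d ε - 8 ε²`. Half
          -- of the gain `2 δ d²` covers `24 d ε`, the other half the loss `10 δ d ε`.
          ≤⟨ ≤-+-nonneg (0≤-* 0≤M (0≤-+ (0≤-+ (0≤-* 0≤d 0≤δd-24ε)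
               (0≤-* (0≤-* 0≤δ 0≤d) (0≤-+ 0≤d-24ε (0≤-* (0≤ℕ→ℚ 14) 0≤ε))))
               (0≤-* (0≤-* (0≤ℕ→ℚ 8) (0≤-* 0≤ε 0≤ε)) (0≤-+ (0≤ℕ→ℚ 1) 0≤δ))))
             (solve 4 (λ d e s M →
               (M :+ s :* M) :* ((lit 20 :* e :+ (d :- lit 24 :* e)) :* ((lit 23 :* e :+ (d :- lit 24 :* e)) :* lit 2))
               := lit 2 :* d :* ((d :+ lit 7 :* e) :* M) :+
               M :* (d :* (s :* d :- lit 24 :* e) :+ s :* d :* (d :- lit 24 :* e :+ lit 14 :* e)
                 :+ lit 8 :* (e :* e) :* (lit 1 :+ s))) refl d ε δ M) ⟩
        (M + δ * M) * ((ℕ→ℚ 20 * ε + (d - ℕ→ℚ 24 * ε)) * ((ℕ→ℚ 23 * ε + (d - ℕ→ℚ 24 * ε)) * ℕ→ℚ 2)) ∎)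
        where
        open ≤-Reasoning
        0<d-kε : ∀ k .{{_ : Positive (ℕ→ℚ k)}} → 0ℚ < ℕ→ℚ k * ε + (d - ℕ→ℚ 24 * ε)
        0<d-kε k = +-mono-<-≤ (0<-* (positive⁻¹ (ℕ→ℚ k)) 0<ε) 0≤d-24ε
        0≤d-4ε : 0ℚ ≤ d - ℕ→ℚ 4 * ε
        0≤d-4ε = subst (0ℚ ≤_) (solve 2 (λ d e → d :- lit 24 :* e :+ lit 20 :* e := d :- lit 4 :* e) refl d ε)
          (0≤-+ 0≤d-24ε (0≤-* (0≤ℕ→ℚ 20) 0≤ε))

-- Counting in lists

private variable
  A B : Set

-- Induction on `xs`: one occurrence of `f x` is cut out of `ys`, and injectivity keeps the
-- remaining images off the gap.
length-injection : ∀ {xs : List A} {ys : List B} (f : A → B) → Unique xs →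
  (∀ {x} → x ∈ xs → f x ∈ ys) →
  (∀ {x y} → x ∈ xs → y ∈ xs → f x ≡ f y → x ≡ y) →
  length xs ℕ.≤ length ys
length-injection {xs = []} f _ _ _ = ℕ.z≤n
length-injection {xs = x ∷ xs} f (x∉xs ∷ uniq) into inj with ∈-∃++ (into (here refl))
... | ys₁ , ys₂ , refl = begin
    suc (length xs)              ≤⟨ ℕ.s≤s (length-injection f uniq into′ λ p q → inj (there p) (there q)) ⟩
    suc (length (ys₁ ++ ys₂))    ≡⟨ cong suc (length-++ ys₁) ⟩
    suc (length ys₁ ℕ.+ length ys₂) ≡⟨ ℕₚ.+-suc (length ys₁) (length ys₂) ⟨
    length ys₁ ℕ.+ length (f x ∷ ys₂) ≡⟨ length-++ ys₁ ⟨
    length (ys₁ ++ f x ∷ ys₂)    ∎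
  where
  open ℕₚ.≤-Reasoning
  into′ : ∀ {y} → y ∈ xs → f y ∈ ys₁ ++ ys₂
  into′ y∈xs with ∈-++⁻ ys₁ (into (there y∈xs))
  ... | inj₁ l = ∈-++⁺ˡ l
  ... | inj₂ (here fy≡fx) = contradiction (inj (here refl) (there y∈xs) (sym fy≡fx)) (All.lookup x∉xs y∈xs)
  ... | inj₂ (there r) = ∈-++⁺ʳ ys₁ r

-- Injectivity is asked only on elements passing `p`, since a switching can be undone only when its
-- choice is admissible. Used in both directions, this also proves equality of counts.
filter-injection : (p : A → Bool) (q : B → Bool) {xs : List A} {ys : List B} → Unique xs →
  (f : A → B) →
  (∀ {x} → x ∈ xs → T (p x) → f x ∈ ys × T (q (f x))) →
  (∀ {x y} → x ∈ xs → y ∈ xs → T (p x) → T (p y) → f x ≡ f y → x ≡ y) →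
  length (filterᵇ p xs) ℕ.≤ length (filterᵇ q ys)
filter-injection p q {xs} uniq f into inj = length-injection f (Unique.filter⁺ (T? ∘ p) uniq)
  (λ x∈ → let x∈xs , px = ∈-filter⁻ (T? ∘ p) {xs = xs} x∈
              fx∈ys , qfx = into x∈xs px
          in ∈-filter⁺ (T? ∘ q) fx∈ys qfx)
  (λ x∈ y∈ → let x∈xs , px = ∈-filter⁻ (T? ∘ p) {xs = xs} x∈
                 y∈xs , py = ∈-filter⁻ (T? ∘ p) {xs = xs} y∈
             in inj x∈xs y∈xs px py)

length-filter-map : (p : B → Bool) (f : A → B) (xs : List A) →
  length (filterᵇ p (map f xs)) ≡ length (filterᵇ (p ∘ f) xs)
length-filter-map p f [] = refl
length-filter-map p f (x ∷ xs) with p (f x)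
... | true  = cong suc (length-filter-map p f xs)
... | false = length-filter-map p f xs

length-filter-× : (p : A × B → Bool) (xs : List A) (ys : List B) →
  length (filterᵇ p (cartesianProduct xs ys)) ≡ lsum (map (λ x → length (filterᵇ (λ y → p (x , y)) ys)) xs)
length-filter-× p [] ys = refl
length-filter-× p (x ∷ xs) ys = begin
  length (filterᵇ p (map (x ,_) ys ++ cartesianProduct xs ys))
    ≡⟨ cong length (filter-++ (T? ∘ p) (map (x ,_) ys) _) ⟩
  length (filterᵇ p (map (x ,_) ys) ++ filterᵇ p (cartesianProduct xs ys))
    ≡⟨ length-++ (filterᵇ p (map (x ,_) ys)) ⟩
  length (filterᵇ p (map (x ,_) ys)) ℕ.+ length (filterᵇ p (cartesianProduct xs ys))
    ≡⟨ cong₂ ℕ._+_ (length-filter-map p (x ,_) ys) (length-filter-× p xs ys) ⟩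
  length (filterᵇ (λ y → p (x , y)) ys) ℕ.+ lsum (map (λ x → length (filterᵇ (λ y → p (x , y)) ys)) xs) ∎
  where open ≡-Reasoning

length-filter-∨ : (p q : A → Bool) (xs : List A) →
  length (filterᵇ (λ x → p x ∨ q x) xs) ℕ.≤ length (filterᵇ p xs) ℕ.+ length (filterᵇ q xs)
length-filter-∨ p q [] = ℕ.z≤n
length-filter-∨ p q (x ∷ xs) with p x | q x
... | true  | true  = ℕ.s≤s (ℕₚ.≤-trans (length-filter-∨ p q xs) (ℕₚ.+-monoʳ-≤ _ (ℕₚ.n≤1+n _)))
... | true  | false = ℕ.s≤s (length-filter-∨ p q xs)
... | false | true  = ℕₚ.≤-trans (ℕ.s≤s (length-filter-∨ p q xs)) (ℕₚ.≤-reflexive (sym (ℕₚ.+-suc _ _)))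
... | false | false = length-filter-∨ p q xs

length-filter-∖ : (p q : A → Bool) (xs : List A) →
  length (filterᵇ p xs) ℕ.≤ length (filterᵇ (λ x → p x ∧ not (q x)) xs) ℕ.+ length (filterᵇ q xs)
length-filter-∖ p q [] = ℕ.z≤n
length-filter-∖ p q (x ∷ xs) with p x | q x
... | true  | true  = ℕₚ.≤-trans (ℕ.s≤s (length-filter-∖ p q xs)) (ℕₚ.≤-reflexive (sym (ℕₚ.+-suc _ _)))
... | true  | false = ℕ.s≤s (length-filter-∖ p q xs)
... | false | true  = ℕₚ.≤-trans (length-filter-∖ p q xs) (ℕₚ.+-monoʳ-≤ _ (ℕₚ.n≤1+n _))
... | false | false = length-filter-∖ p q xs

filter-nonempty : (p : A → Bool) (xs : List A) → 0 ℕ.< length (filterᵇ p xs) → ∃ λ x → T (p x)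
filter-nonempty p xs 0<l with filterᵇ p xs in eq
... | x ∷ _ = x , proj₂ (∈-filter⁻ (T? ∘ p) {xs = xs} (subst (x ∈_) (sym eq) (here refl)))

concatMap-map≡ : {C : Set} (f : A → B → C) (xs : List A) (ys : List B) →
  concatMap (λ x → map (f x) ys) xs ≡ cartesianProductWith f xs ys
concatMap-map≡ f [] ys = refl
concatMap-map≡ f (x ∷ xs) ys = cong (map (f x) ys ++_) (concatMap-map≡ f xs ys)

allVecs-unique : ∀ n k → Unique (allVecs n k)
allVecs-unique n zero    = [] ∷ []
allVecs-unique n (suc k) = subst Unique (sym (concatMap-map≡ (λ v i → i ∷ v) (allVecs n k) (allFin n)))
  (Unique.cartesianProductWith⁺ (λ v i → i ∷ v) (λ eq → Vec.∷-injectiveʳ eq , Vec.∷-injectiveˡ eq)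
    (allVecs-unique n k) (Unique.allFin⁺ n))

∈-allVecs : ∀ {n k} (v : Vec (Fin n) k) → v ∈ allVecs n k
∈-allVecs [] = here refl
∈-allVecs {n} {suc k} (i ∷ v) = subst (i ∷ v ∈_) (sym (concatMap-map≡ (λ v i → i ∷ v) (allVecs n k) (allFin n)))
  (∈-cartesianProductWith⁺ (λ v i → i ∷ v) (∈-allVecs v) (∈-allFin i))

pairs : ∀ n → List (Fin n × Fin n)
pairs n = cartesianProduct (allFin n) (allFin n)

pairs-unique : ∀ n → Unique (pairs n)
pairs-unique n = Unique.cartesianProduct⁺ (Unique.allFin⁺ n) (Unique.allFin⁺ n)

∈-pairs : ∀ {n} (p : Fin n × Fin n) → p ∈ pairs n
∈-pairs (i , j) = ∈-cartesianProduct⁺ (∈-allFin i) (∈-allFin j)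

-- The junk value y is never met when f is injective.
preimage : ∀ {n} → (Fin n → Fin n) → Fin n → Fin n
preimage f y with any? (λ x → f x ≟ y)
... | yes (x , _) = x
... | no _        = y

module _ {n} {f : Fin n → Fin n} (inj : Injective _≡_ _≡_ f) where

  f∘preimage : ∀ y → f (preimage f y) ≡ y
  f∘preimage y with any? (λ x → f x ≟ y)
  ... | yes (_ , fx≡y) = fx≡y
  ... | no ∄x = contradiction (avoids f inj y (λ x fx≡y → ∄x (x , fx≡y))) λ ()
    where
    -- Punching a missed value out of the codomain would inject `Fin (suc n)` into `Fin n`.
    avoids : ∀ {n} (f : Fin n → Fin n) → Injective _≡_ _≡_ f → ∀ y → (∀ x → f x ≢ y) → ⊥
    avoids {suc n} f inj y f≢y = ℕₚ.1+n≰n (injective⇒≤ {f = λ x → punchOut (f≢y x ∘ sym)}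
      (λ {x} {z} eq → inj (punchOut-injective (f≢y x ∘ sym) (f≢y z ∘ sym) eq)))

  preimage-unique : ∀ {x y} → f x ≡ y → preimage f y ≡ x
  preimage-unique fx≡y = inj (trans (f∘preimage _) (sym fx≡y))

  preimage-injective : Injective _≡_ _≡_ (preimage f)
  preimage-injective eq = trans (sym (f∘preimage _)) (trans (cong f eq) (f∘preimage _))

module _ {n} (i j : Fin n) where

  transpose-left : transpose i j i ≡ j
  transpose-left rewrite dec-true (i ≟ i) refl = refl

  transpose-right : transpose i j j ≡ i
  transpose-right with j ≟ i
  ... | yes j≡i = j≡i
  ... | no _ rewrite dec-true (j ≟ j) refl = refl

  transpose-other : ∀ {k} → k ≢ i → k ≢ j → transpose i j k ≡ k
  transpose-other {k} k≢i k≢j rewrite dec-false (k ≟ i) k≢i | dec-false (k ≟ j) k≢j = refl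

  transpose-injective : Injective _≡_ _≡_ (transpose i j)
  transpose-injective eq = trans (sym (transpose-inverse j i)) (trans (cong (transpose j i) eq) (transpose-inverse j i))

-- Matchings and switchings

∧⁺ : ∀ {x y} → T x → T y → T (x ∧ y)
∧⁺ p q = Equivalence.from T-∧ (p , q)

∧⁻ : ∀ {x y} → T (x ∧ y) → T x × T y
∧⁻ = Equivalence.to T-∧

not⁻ : ∀ {x} → T (not x) → ¬ T x
not⁻ {false} _ ()

not⁺ : ∀ {x} → ¬ T x → T (not x)
not⁺ {false} _  = tt
not⁺ {true}  ¬p = ¬p tt

module _ {n} {P : Fin n → Bool} where

  allᵇ⁻ : T (allᵇ P) → ∀ i → T (P i)
  allᵇ⁻ h i = All.lookup (All.all⁺ P (allFin n) h) (∈-allFin i)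

  allᵇ⁺ : (∀ i → T (P i)) → T (allᵇ P)
  allᵇ⁺ h = All.all⁻ P (All.universal h (allFin n))

IsMatching : ∀ {n} → BipGraph n → (Fin n → Fin n) → Set
IsMatching E f = Injective _≡_ _≡_ f × (∀ x → T (E x (f x)))

module _ {n} (E : BipGraph n) (σ : Vec (Fin n) n) where

  isPM⁻ : T (isPM E σ) → IsMatching E (lookup σ)
  isPM⁻ h with ∧⁻ h
  ... | edges , inj = injective , allᵇ⁻ edges
    where
    injective : Injective _≡_ _≡_ (lookup σ)
    injective {i} {j} eq with Equivalence.to (T-∨ {i == j}) (allᵇ⁻ (allᵇ⁻ inj i) j)
    ... | inj₁ i==j = toWitness {a? = i ≟ j} i==j
    ... | inj₂ neq  = contradiction (fromWitness {a? = lookup σ i ≟ lookup σ j} eq) (not⁻ neq)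

  isPM⁺ : IsMatching E (lookup σ) → T (isPM E σ)
  isPM⁺ (inj , edges) = ∧⁺ (allᵇ⁺ edges) (allᵇ⁺ λ i → allᵇ⁺ λ j → distinct i j)
    where
    distinct : ∀ i j → T ((i == j) ∨ not (lookup σ i == lookup σ j))
    distinct i j with i ≟ j
    ... | yes _   = tt
    ... | no  i≢j = not⁺ λ eq → i≢j (inj (toWitness eq))

-- For a matching f, the pairs (a , b) give the walks x – f b – b – f a – a – y.
walk : ∀ {n} → BipGraph n → (Fin n → Fin n) → Fin n → Fin n → Fin n × Fin n → Bool
walk E f x y (a , b) = E x (f b) ∧ E a y ∧ E b (f a)

numWalks : ∀ {n} → BipGraph n → (Fin n → Fin n) → Fin n → Fin n → ℕ
numWalks {n} E f x y = length (filterᵇ (walk E f x y) (pairs n))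

module _ {n} (E : BipGraph n) {f : Fin n → Fin n} (inj : Injective _≡_ _≡_ f) (x y : Fin n) where

  -- These are the preimage under `f` of the neighbourhood of `x` and the image under `f` of the
  -- neighbourhood of `y`, so their sizes are degrees.
  walkStart walkEnd : Sub n
  walkStart b = E x (f b)
  walkEnd c = E (preimage f c) y

  count-walkStart : count walkStart ≡ degU E x
  count-walkStart = ℕₚ.≤-antisym
    (filter-injection walkStart (E x) (Unique.allFin⁺ n) f (λ _ p → ∈-allFin _ , p) (λ _ _ _ _ → inj))
    (filter-injection (E x) walkStart (Unique.allFin⁺ n) (preimage f)
      (λ {c} _ p → ∈-allFin _ , subst (T ∘ E x) (sym (f∘preimage inj c)) p)
      (λ _ _ _ _ → preimage-injective inj))

  count-walkEnd : count walkEnd ≡ degW E y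
  count-walkEnd = ℕₚ.≤-antisym
    (filter-injection walkEnd (λ a → E a y) (Unique.allFin⁺ n) (preimage f) (λ _ p → ∈-allFin _ , p)
      (λ _ _ _ _ → preimage-injective inj))
    (filter-injection (λ a → E a y) walkEnd (Unique.allFin⁺ n) f
      (λ {a} _ p → ∈-allFin _ , subst (λ a → T (E a y)) (sym (preimage-unique inj refl)) p)
      (λ _ _ _ _ → inj))

  -- A walk is determined by its middle edge: `(a , b)` corresponds to the edge from `b` to `f a`.
  -- This turns walk counts into edge counts, to which regularity applies.
  eG-walk : eG E walkStart walkEnd ≡ numWalks E f x y
  eG-walk = trans (sym (length-filter-× edge (allFin n) (allFin n))) (ℕₚ.≤-antisym
    (filter-injection edge (walk E f x y) (pairs-unique n) (λ (b , c) → preimage f c , b)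
      (λ {(b , c)} _ p → ∈-pairs _ , let p₁ , p₂₃ = ∧⁻ {walkStart b} p ; p₂ , p₃ = ∧⁻ {walkEnd c} p₂₃ in
        ∧⁺ {walkStart b} p₁ (∧⁺ {walkEnd c} p₂ (subst (T ∘ E b) (sym (f∘preimage inj c)) p₃)))
      (λ _ _ _ _ eq → cong₂ _,_ (cong proj₂ eq) (preimage-injective inj (cong proj₁ eq))))
    (filter-injection (walk E f x y) edge (pairs-unique n) (λ (a , b) → b , f a)
      (λ {(a , b)} _ p → ∈-pairs _ , let p₁ , p₂₃ = ∧⁻ {E x (f b)} p ; p₂ , p₃ = ∧⁻ {E a y} p₂₃ in
        ∧⁺ {walkStart b} p₁ (∧⁺ {walkEnd (f a)} (subst (λ a → T (E a y)) (sym (preimage-unique inj refl)) p₂) p₃))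
      (λ _ _ _ _ eq → cong₂ _,_ (inj (cong proj₂ eq)) (cong proj₁ eq))))
    where
    edge : Fin n × Fin n → Bool
    edge (b , c) = walkStart b ∧ walkEnd c ∧ E b c

-- Existence of a perfect matching

module _ {n} (E : BipGraph n)
         (connected : ∀ {f} → Injective _≡_ _≡_ f → ∀ x y → 0 ℕ.< numWalks E f x y) where

  private
    -- If `x` is matched along a non-edge, a walk from `x` to `f x` supplies edges from `x`, `b`,
    -- `a` to `f b`, `f a`, `f x`. Matching along these repairs `x` and moves no other vertex.
    improve : ∀ {f} → Injective _≡_ _≡_ f → ∀ x →
      Σ (Fin n → Fin n) λ g → Injective _≡_ _≡_ g × T (E x (g x)) × (∀ y → T (E y (f y)) → T (E y (g y)))
    improve {f} inj x with T? (E x (f x))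
    ... | yes xfx = f , inj , xfx , λ _ → id
    ... | no ¬xfx with filter-nonempty (walk E f x (f x)) (pairs n) (connected inj x (f x))
    ...   | (a , b) , p with ∧⁻ p
    ...     | xfb , q with ∧⁻ q
    ...       | afx , bfa = f ∘ π , (λ eq → transpose-injective b a (transpose-injective x b (inj eq))) , good-x , preserve
      where
      -- The cycle x → b → a → x, which degenerates to the swap of `x` and `b` when `a` equals `b`.
      π : Fin n → Fin n
      π = transpose x b ∘ transpose b a
      -- If `a` or `b` were `x`, the walk would contain the non-edge from `x` to `f x`.
      x≢a : x ≢ a
      x≢a refl = ¬xfx afx
      x≢b : x ≢ b
      x≢b refl = ¬xfx xfb
      πx≡b : π x ≡ b
      πx≡b = trans (cong (transpose x b) (transpose-other b a x≢b x≢a)) (transpose-left x b)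
      πa≡x : π a ≡ x
      πa≡x = trans (cong (transpose x b) (transpose-right b a)) (transpose-right x b)
      πb≡a : b ≢ a → π b ≡ a
      πb≡a b≢a = trans (cong (transpose x b) (transpose-left b a)) (transpose-other x b (x≢a ∘ sym) (b≢a ∘ sym))
      via : ∀ {y z} → π y ≡ z → T (E y (f z)) → T (E y (f (π y)))
      via {y} eq = subst (λ z → T (E y (f z))) (sym eq)
      good-x : T (E x (f (π x)))
      good-x = via πx≡b xfb
      preserve : ∀ y → T (E y (f y)) → T (E y (f (π y)))
      preserve y yfy = cases (y ≟ x) (y ≟ a) (y ≟ b)
        where
        cases : Dec (y ≡ x) → Dec (y ≡ a) → Dec (y ≡ b) → T (E y (f (π y)))
        cases (yes refl) _          _          = good-x
        cases (no _)     (yes refl) _          = via πa≡x afx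
        -- The degenerate case `a ≡ b` has been caught by the test against `a`, so `b ≢ a` is
        -- available here.
        cases (no _)     (no y≢a)   (yes refl) = via (πb≡a y≢a) bfa
        cases (no y≢x)   (no y≢a)   (no y≢b)   =
          via (trans (cong (transpose x b) (transpose-other b a y≢b y≢a)) (transpose-other x b y≢x y≢b)) yfy

    improve-all : (xs : List (Fin n)) → Σ (Fin n → Fin n) λ f → Injective _≡_ _≡_ f × All (λ x → T (E x (f x))) xs
    improve-all []       = id , id , []
    improve-all (x ∷ xs) with improve-all xs
    ... | f , inj , good with improve inj x
    ...   | g , inj′ , good-x , keep = g , inj′ , good-x ∷ All.map (keep _) good

  0<numPM : 0 ℕ.< numPM E
  0<numPM with improve-all (allFin n)
  ... | f , inj , good = ∈-length (∈-filter⁺ (T? ∘ isPM E) (∈-allVecs (tabulate f)) (isPM⁺ E (tabulate f) matching))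
    where
    matching : IsMatching E (lookup (tabulate f))
    matching =
      (λ {x} {y} eq → inj (trans (sym (Vec.lookup∘tabulate f x)) (trans eq (Vec.lookup∘tabulate f y)))) ,
      (λ x → subst (T ∘ E x) (sym (Vec.lookup∘tabulate f x)) (All.lookup good (∈-allFin x)))

-- Matchings split by the edge at a vertex; collisions and rotations

isPMe : ∀ {n} → BipGraph n → Fin n → Fin n → Vec (Fin n) n → Bool
isPMe E u w σ = isPM E σ ∧ (lookup σ u == w)

-- Each perfect matching `σ` is counted once, at the neighbour `σ(u)` of `u`.
numPM-split : ∀ {n} (E : BipGraph n) u → numPM E ≡ lsum (map (numPMe E u) (filterᵇ (E u) (allFin n)))
numPM-split {n} E u = trans (ℕₚ.≤-antisym
  (filter-injection (isPM E) at (allVecs-unique n n) (λ σ → lookup σ u , σ)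
    (λ {σ} _ pm → ∈-cartesianProduct⁺ (∈-filter⁺ (T? ∘ E u) (∈-allFin _) (proj₂ (isPM⁻ E σ pm) u)) (∈-allVecs σ) ,
      ∧⁺ pm (fromWitness refl))
    (λ _ _ _ _ → cong proj₂))
  (filter-injection at (isPM E) (Unique.cartesianProduct⁺ (Unique.filter⁺ (T? ∘ E u) (Unique.allFin⁺ n)) (allVecs-unique n n)) proj₂
    (λ {(_ , σ)} _ p → ∈-allVecs σ , proj₁ (∧⁻ p))
    (λ {(_ , σ)} {(_ , τ)} _ _ p q eq → cong₂ _,_
      (trans (sym (toWitness (proj₂ (∧⁻ {isPM E σ} p)))) (trans (cong (λ ρ → lookup ρ u) eq) (toWitness (proj₂ (∧⁻ {isPM E τ} q))))) eq)))
  (length-filter-× at (filterᵇ (E u) (allFin n)) (allVecs n n))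
  where
  at : Fin n × Vec (Fin n) n → Bool
  at (w , σ) = isPMe E u w σ

-- Five of the six coincidences among `u`, `a`, `b`, `c`; the sixth, `u = c`, is excluded by
-- `w ≢ w′`.
collides : ∀ {n} → Fin n → Fin n → Fin n × Fin n → Bool
collides u c (a , b) = (a == u) ∨ (a == c) ∨ (b == u) ∨ (b == c) ∨ (a == b)

-- Each coincidence fixes one coordinate or ties it to the other, so it leaves at most `n` pairs.
numCollisions : ∀ {n} (u c : Fin n) → length (filterᵇ (collides u c) (pairs n)) ℕ.≤ 5 ℕ.* n
numCollisions {n} u c =
  union (λ (a , b) → a == u) _ (bound _ proj₂ (λ {(a , b)} {(a′ , b′)} p q eq → cong₂ _,_ (trans (toWitness p) (sym (toWitness q))) eq))
  (union (λ (a , b) → a == c) _ (bound _ proj₂ (λ {(a , b)} {(a′ , b′)} p q eq → cong₂ _,_ (trans (toWitness p) (sym (toWitness q))) eq))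
  (union (λ (a , b) → b == u) _ (bound _ proj₁ (λ {(a , b)} {(a′ , b′)} p q eq → cong₂ _,_ eq (trans (toWitness p) (sym (toWitness q)))))
  (union (λ (a , b) → b == c) _ (bound _ proj₁ (λ {(a , b)} {(a′ , b′)} p q eq → cong₂ _,_ eq (trans (toWitness p) (sym (toWitness q)))))
  (ℕₚ.≤-trans (bound (λ (a , b) → a == b) proj₁
    (λ {(a , b)} {(a′ , b′)} p q eq → cong₂ _,_ eq (trans (sym (toWitness p)) (trans eq (toWitness q)))))
    (ℕₚ.≤-reflexive (sym (ℕₚ.+-identityʳ n)))))))
  where
  bound : (p : Fin n × Fin n → Bool) (f : Fin n × Fin n → Fin n) →
    (∀ {x y} → T (p x) → T (p y) → f x ≡ f y → x ≡ y) → length (filterᵇ p (pairs n)) ℕ.≤ n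
  bound p f inj = subst (length (filterᵇ p (pairs n)) ℕ.≤_) (length-tabulate {n = n} id)
    (length-injection {ys = allFin n} f (Unique.filter⁺ (T? ∘ p) (pairs-unique n)) (λ _ → ∈-allFin _)
    (λ x∈ y∈ → inj (proj₂ (∈-filter⁻ (T? ∘ p) {xs = pairs n} x∈)) (proj₂ (∈-filter⁻ (T? ∘ p) {xs = pairs n} y∈))))
  union : ∀ (p q : Fin n × Fin n → Bool) {k l} → length (filterᵇ p (pairs n)) ℕ.≤ k → length (filterᵇ q (pairs n)) ℕ.≤ l →
    length (filterᵇ (λ x → p x ∨ q x) (pairs n)) ℕ.≤ k ℕ.+ l
  union p q hp hq = ℕₚ.≤-trans (length-filter-∨ p q (pairs n)) (ℕₚ.+-mono-≤ hp hq)

collides⁻ : ∀ {n} {u c a b : Fin n} → ¬ T (collides u c (a , b)) → a ≢ u × a ≢ c × b ≢ u × b ≢ c × a ≢ b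
collides⁻ {u = u} {c} {a} {b} h with a ≟ u | a ≟ c | b ≟ u | b ≟ c | a ≟ b
... | no p  | no q  | no r  | no s  | no t  = p , q , r , s , t
... | yes _ | _     | _     | _     | _     = contradiction tt h
... | no _  | yes _ | _     | _     | _     = contradiction tt h
... | no _  | no _  | yes _ | _     | _     = contradiction tt h
... | no _  | no _  | no _  | yes _ | _     = contradiction tt h
... | no _  | no _  | no _  | no _  | yes _ = contradiction tt h

module Rotation {n} (u a b c : Fin n) where

  -- On distinct vertices this is the four-cycle u → c → b → a → u. As a product of transpositions
  -- it is invertible for all vertices.
  rotate rotate⁻¹ : Fin n → Fin n
  rotate = transpose b c ∘ transpose a b ∘ transpose u a
  rotate⁻¹ = transpose a u ∘ transpose b a ∘ transpose c b

  rotate-rotate⁻¹ : ∀ x → rotate (rotate⁻¹ x) ≡ x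
  rotate-rotate⁻¹ x = trans (cong (transpose b c ∘ transpose a b) (transpose-inverse u a {transpose b a (transpose c b x)}))
    (trans (cong (transpose b c) (transpose-inverse a b {transpose c b x})) (transpose-inverse b c {x}))

  rotate-injective : Injective _≡_ _≡_ rotate
  rotate-injective eq = transpose-injective u a (transpose-injective a b (transpose-injective b c eq))

  rotate-u : rotate u ≡ c
  rotate-u = trans (cong (transpose b c ∘ transpose a b) (transpose-left u a))
    (trans (cong (transpose b c) (transpose-left a b)) (transpose-left b c))

  module _ (a≢u : a ≢ u) (a≢c : a ≢ c) (b≢u : b ≢ u) (b≢c : b ≢ c) (a≢b : a ≢ b) (u≢c : u ≢ c) where

    rotate-a : rotate a ≡ u
    rotate-a = trans (cong (transpose b c ∘ transpose a b) (transpose-right u a))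
      (trans (cong (transpose b c) (transpose-other a b (a≢u ∘ sym) (b≢u ∘ sym))) (transpose-other b c (b≢u ∘ sym) u≢c))

    rotate-b : rotate b ≡ a
    rotate-b = trans (cong (transpose b c ∘ transpose a b) (transpose-other u a b≢u (a≢b ∘ sym)))
      (trans (cong (transpose b c) (transpose-right a b)) (transpose-other b c a≢b a≢c))

    rotate-c : rotate c ≡ b
    rotate-c = trans (cong (transpose b c ∘ transpose a b) (transpose-other u a (u≢c ∘ sym) (a≢c ∘ sym)))
      (trans (cong (transpose b c) (transpose-other a b (a≢c ∘ sym) (b≢c ∘ sym))) (transpose-right b c))

  rotate-other : ∀ {x} → x ≢ u → x ≢ a → x ≢ b → x ≢ c → rotate x ≡ x
  rotate-other x≢u x≢a x≢b x≢c = trans (cong (transpose b c ∘ transpose a b) (transpose-other u a x≢u x≢a))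
    (trans (cong (transpose b c) (transpose-other a b x≢a x≢b)) (transpose-other b c x≢b x≢c))

-- Switching a matching from u w to u w′

module Switching {n} (E : BipGraph n) (u w w′ : Fin n) (w≢w′ : w ≢ w′) (uw′ : T (E u w′)) where

  open Rotation using (rotate; rotate⁻¹; rotate-rotate⁻¹; rotate-injective)

  Choice : Set
  Choice = Vec (Fin n) n × Fin n × Fin n

  pivot : Vec (Fin n) n → Fin n
  pivot σ = preimage (lookup σ) w′

  -- The edges that a switching adds, besides u w′, form a walk from the pivot `c` to `w` in the old
  -- matching; those it removes, besides u w, form a walk from `a` to `w′` in the new one, where `a`
  -- is the partner of `w`. Collisions are barred in `forward` because the rotation must be a
  -- genuine four-cycle; `backward` is only bounded from above.
  forward backward : Choice → Bool
  forward (σ , p) = walk E (lookup σ) (pivot σ) w p ∧ not (collides u (pivot σ) p)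
  backward (σ , p) = walk E (lookup σ) (preimage (lookup σ) w) w′ p

  switch : Vec (Fin n) n → Fin n → Fin n → Vec (Fin n) n
  switch σ a b = tabulate (lookup σ ∘ rotate u a b (pivot σ))

  -- The pair recorded is `c` and `b`; the new matching itself remembers `a` as the partner of `w`.
  step : Choice → Choice
  step (σ , a , b) = switch σ a b , pivot σ , b

  matchings : Fin n → List (Vec (Fin n) n)
  matchings v = filterᵇ (isPMe E u v) (allVecs n n)

  choices : Fin n → List Choice
  choices v = cartesianProduct (matchings v) (pairs n)

  module _ (σ : Vec (Fin n) n) (a b : Fin n) (pm : T (isPMe E u w σ)) (fwd : T (forward (σ , a , b))) where

    private
      f : Fin n → Fin n
      f = lookup σ

      c : Fin n
      c = pivot σ

      f-inj : Injective _≡_ _≡_ f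
      f-inj = proj₁ (isPM⁻ E σ (proj₁ (∧⁻ pm)))

      edge : ∀ x → T (E x (f x))
      edge = proj₂ (isPM⁻ E σ (proj₁ (∧⁻ pm)))

      fu≡w : f u ≡ w
      fu≡w = toWitness (proj₂ (∧⁻ {isPM E σ} pm))

      fc≡w′ : f c ≡ w′
      fc≡w′ = f∘preimage f-inj w′

      u≢c : u ≢ c
      u≢c u≡c = w≢w′ (trans (sym fu≡w) (trans (cong f u≡c) fc≡w′))

      walks : T (E c (f b)) × T (E a w ∧ E b (f a))
      walks = ∧⁻ (proj₁ (∧⁻ {walk E f c w (a , b)} fwd))

      distinct : a ≢ u × a ≢ c × b ≢ u × b ≢ c × a ≢ b
      distinct = collides⁻ (not⁻ (proj₂ (∧⁻ {walk E f c w (a , b)} fwd)))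

      g : Fin n → Fin n
      g = lookup (switch σ a b)

      g≡ : ∀ {x y} → rotate u a b c x ≡ y → g x ≡ f y
      g≡ {x} eq = trans (Vec.lookup∘tabulate _ x) (cong f eq)

      gu : g u ≡ f c
      gu = g≡ (Rotation.rotate-u u a b c)

      ga : g a ≡ f u
      ga = let p , q , r , s , t = distinct in g≡ (Rotation.rotate-a u a b c p q r s t u≢c)

      gb : g b ≡ f a
      gb = let p , q , r , s , t = distinct in g≡ (Rotation.rotate-b u a b c p q r s t u≢c)

      gc : g c ≡ f b
      gc = let p , q , r , s , t = distinct in g≡ (Rotation.rotate-c u a b c p q r s t u≢c)

      via : ∀ {x y} → g x ≡ y → T (E x y) → T (E x (g x))
      via {x} eq = subst (T ∘ E x) (sym eq)

      g-edge : ∀ x → T (E x (g x))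
      g-edge x with x ≟ u | x ≟ a | x ≟ b | x ≟ c
      ... | yes refl | _        | _        | _        = via (trans gu fc≡w′) uw′
      ... | no _     | yes refl | _        | _        = via (trans ga fu≡w) (proj₁ (∧⁻ (proj₂ walks)))
      ... | no _     | no _     | yes refl | _        = via gb (proj₂ (∧⁻ {E a w} (proj₂ walks)))
      ... | no _     | no _     | no _     | yes refl = via gc (proj₁ walks)
      ... | no x≢u   | no x≢a   | no x≢b   | no x≢c   = via (g≡ (Rotation.rotate-other u a b c x≢u x≢a x≢b x≢c)) (edge x)

    switch-injective : Injective _≡_ _≡_ (lookup (switch σ a b))
    switch-injective {x} {y} eq = rotate-injective u a b c
      (f-inj (trans (sym (g≡ refl)) (trans eq (g≡ refl))))

    switch-a : lookup (switch σ a b) a ≡ w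
    switch-a = trans ga fu≡w

    switch-isPMe : T (isPMe E u w′ (switch σ a b))
    switch-isPMe = ∧⁺ (isPM⁺ E (switch σ a b) (switch-injective , g-edge)) (fromWitness (trans gu fc≡w′))

    -- The three edges of the new walk are the old matching edges at `a`, `c` and `b`.
    step-backward : T (backward (step (σ , a , b)))
    step-backward = ∧⁺ (subst₂ (λ x y → T (E x y)) (sym (preimage-unique switch-injective switch-a)) (sym gb) (edge a))
      (∧⁺ (subst (T ∘ E c) fc≡w′ (edge c)) (subst (T ∘ E b) (sym gc) (edge b)))

  -- `b` and the pivot are read off, `a` is the vertex now matched to `w`, and inverting the
  -- resulting rotation recovers `σ`.
  step-injective : ∀ σ τ a b a′ b′ → T (isPMe E u w σ) → T (isPMe E u w τ) →
    T (forward (σ , a , b)) → T (forward (τ , a′ , b′)) →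
    step (σ , a , b) ≡ step (τ , a′ , b′) → (σ , a , b) ≡ (τ , a′ , b′)
  step-injective σ τ a b a′ b′ pmσ pmτ fwdσ fwdτ eq = cong₂ _,_ σ≡τ (cong₂ _,_ a≡a′ b≡b′)
    where
    b≡b′ : b ≡ b′
    b≡b′ = cong (proj₂ ∘ proj₂) eq
    a≡a′ : a ≡ a′
    a≡a′ = switch-injective σ a b pmσ fwdσ (trans (switch-a σ a b pmσ fwdσ)
      (trans (sym (switch-a τ a′ b′ pmτ fwdτ)) (cong (λ s → lookup (proj₁ s) a′) (sym eq))))
    ρ≡ : rotate u a b (pivot σ) ≡ rotate u a′ b′ (pivot τ)
    ρ≡ = cong₂ (λ (x , y) z → rotate u x y z) (cong₂ _,_ a≡a′ b≡b′) (cong (proj₁ ∘ proj₂) eq)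
    agree : ∀ x → lookup σ (rotate u a b (pivot σ) x) ≡ lookup τ (rotate u a b (pivot σ) x)
    agree x = trans (sym (Vec.lookup∘tabulate _ x)) (trans (cong (λ s → lookup (proj₁ s) x) eq)
      (trans (Vec.lookup∘tabulate _ x) (cong (λ r → lookup τ (r x)) (sym ρ≡))))
    σ≡τ : σ ≡ τ
    σ≡τ = trans (sym (Vec.tabulate∘lookup σ)) (trans (Vec.tabulate-cong λ x →
        subst (λ y → lookup σ y ≡ lookup τ y) (rotate-rotate⁻¹ u a b (pivot σ) x) (agree (rotate⁻¹ u a b (pivot σ) x)))
      (Vec.tabulate∘lookup τ))

  ∈-choices⁻ : ∀ {v} {s : Choice} → s ∈ choices v → T (isPMe E u v (proj₁ s))
  ∈-choices⁻ {v} s∈ = proj₂ (∈-filter⁻ (T? ∘ isPMe E u v) {xs = allVecs n n}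
    (proj₁ (∈-cartesianProduct⁻ (matchings v) (pairs n) s∈)))

  -- Grouping both sides by matching compares the number of matchings through u w with the number
  -- through u w′.
  forward≤backward : length (filterᵇ forward (choices w)) ℕ.≤ length (filterᵇ backward (choices w′))
  forward≤backward = filter-injection forward backward
    (Unique.cartesianProduct⁺ (Unique.filter⁺ (T? ∘ isPMe E u w) (allVecs-unique n n)) (pairs-unique n)) step
    (λ {(σ , a , b)} s∈ fwd → let pm = ∈-choices⁻ s∈ in
      ∈-cartesianProduct⁺ (∈-filter⁺ (T? ∘ isPMe E u w′) (∈-allVecs _) (switch-isPMe σ a b pm fwd)) (∈-pairs _) ,
      step-backward σ a b pm fwd)
    (λ {(σ , a , b)} {(τ , a′ , b′)} s∈ t∈ → step-injective σ τ a b a′ b′ (∈-choices⁻ s∈) (∈-choices⁻ t∈))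

-- Double counting in a super-regular graph

module EdgeShare {d ε : ℚ} {n : ℕ} (0<d : 0ℚ < d) (d≤1 : d ≤ 1ℚ) (0<ε : 0ℚ < ε) (ε≤ : ε ≤ ε-bound d)
  (1≤νn : ℕ→ℚ 1 ≤ ν-bound ε d * ℕ→ℚ n) (E : BipGraph n) (sr : SuperRegular ε d E) (u : Fin n) where

  private
    N = ℕ→ℚ n
    0≤d = <⇒≤ 0<d
    0≤ε = <⇒≤ 0<ε

    0<N : 0ℚ < N
    0<N = <-≤-trans (positive⁻¹ 1ℚ) (ℕ→ℚ-mono-≤ 1 n (pos u))
      where
      pos : ∀ {n} → Fin n → 1 ℕ.≤ n
      pos {suc _} _ = ℕ.s≤s ℕ.z≤n

    degU-≐ = proj₁ (proj₂ sr)
    degW-≐ = proj₂ (proj₂ sr)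

    N²d² = d * d * (N * N)

  module _ {f : Fin n → Fin n} (inj : Injective _≡_ _≡_ f) (x y : Fin n) where

    private
      p = ℕ→ℚ (degU E x)
      q = ℕ→ℚ (degW E y)

    -- Regularity applied to `walkStart` and `walkEnd`, which exceed the threshold by `εN<lower`.
    numWalks-≐ : ℕ→ℚ (numWalks E f x y) ≐ d * (p * q) ± (ε * (p * q))
    numWalks-≐ = subst (λ z → ℕ→ℚ (numWalks E f x y) ≐ d * z ± (ε * z)) (ℕ→ℚ-* (degU E x) (degW E y))
      (subst₂ (λ e k → ℕ→ℚ e ≐ d * ℕ→ℚ k ± (ε * ℕ→ℚ k)) (eG-walk E inj x y)
        (cong₂ ℕ._*_ (count-walkStart E inj x y) (count-walkEnd E inj x y))
        (proj₁ sr (walkStart E inj x y) (walkEnd E inj x y)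
          (subst (λ k → ε * N < ℕ→ℚ k) (sym (count-walkStart E inj x y)) (large (proj₁ (degU-≐ x))))
          (subst (λ k → ε * N < ℕ→ℚ k) (sym (count-walkEnd E inj x y)) (large (proj₁ (degW-≐ y))))))
      where
      large : ∀ {r} → d * N - ε * N ≤ r → ε * N < r
      large = <-≤-trans (εN<lower 0<d d≤1 0<ε ε≤ 0<N)

    numWalks-lower : (d - ε) * ((d * N - ε * N) * (d * N - ε * N)) ≤ ℕ→ℚ (numWalks E f x y)
    numWalks-lower = ≤-trans (cube-lower 0<d d≤1 0<ε ε≤ 0<N {p} {q} (proj₁ (degU-≐ x)) (proj₁ (degW-≐ y))) (proj₁ numWalks-≐)

    numWalks-upper : ℕ→ℚ (numWalks E f x y) ≤ (d + ℕ→ℚ 7 * ε) * N²d²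
    numWalks-upper = ≤-trans (proj₂ numWalks-≐)
      (cube-upper 0<d d≤1 0<ε ε≤ 0<N {p} {q} (0≤ℕ→ℚ (degU E x)) (0≤ℕ→ℚ (degW E y)) (proj₂ (degU-≐ x)) (proj₂ (degW-≐ y)))

  numPM-pos : 0 ℕ.< numPM E
  numPM-pos = 0<numPM E λ inj x y →
    0<ℕ→ℚ⇒0< (numWalks E _ x y) (<-≤-trans (0<cube 0<d d≤1 0<ε ε≤ 0<N) (numWalks-lower inj x y))

  -- The decision is an argument because a with-abstraction would normalise the rationals of the goal.
  numPMe-ratio : ∀ w w′ → Dec (w ≡ w′) → T (E u w′) →
    ℕ→ℚ (numPMe E u w) * (d - ℕ→ℚ 4 * ε) ≤ ℕ→ℚ (numPMe E u w′) * (d + ℕ→ℚ 7 * ε)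
  numPMe-ratio w w′ (yes refl) uw′ = *-monoˡ-≤-nonNeg (ℕ→ℚ (numPMe E u w)) {{nonNegative (0≤ℕ→ℚ (numPMe E u w))}}
    (≤-+-nonneg (0≤-* (0≤ℕ→ℚ 11) 0≤ε)
      (solve 2 (λ d e → d :+ lit 7 :* e := d :- lit 4 :* e :+ lit 11 :* e) refl d ε))
  numPMe-ratio w w′ (no w≢w′) uw′ = ratio-from-totals (ℕ→ℚ (numPMe E u w)) (ℕ→ℚ (numPMe E u w′)) (ℕ→ℚ X) (ℕ→ℚ Y)
    (d - ℕ→ℚ 4 * ε) (d + ℕ→ℚ 7 * ε) N²d²
    (0<-* (0<-* 0<d 0<d) (0<-* 0<N 0<N))
    (sum-lower forwards ((d - ℕ→ℚ 4 * ε) * N²d²) 1ℚ (matchings w) (numPMe E u w) X refl (sym (length-filter-× forward (matchings w) (pairs n)))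
      λ σ σ∈ → ≤-trans (lower σ (inj-of w σ∈)) (≤-reflexive (sym (*-identityˡ (ℕ→ℚ (forwards σ))))))
    (ℕ→ℚ-mono-≤ X Y forward≤backward)
    (sum-upper backwards ((d + ℕ→ℚ 7 * ε) * N²d²) 1ℚ (matchings w′) (numPMe E u w′) Y refl (sym (length-filter-× backward (matchings w′) (pairs n)))
      λ σ σ∈ → ≤-trans (≤-reflexive (*-identityˡ (ℕ→ℚ (backwards σ)))) (numWalks-upper (inj-of w′ σ∈) (preimage (lookup σ) w) w′))
    where
    open ≤-Reasoning
    open Switching E u w w′ w≢w′ uw′
    X = length (filterᵇ forward (choices w))
    Y = length (filterᵇ backward (choices w′))
    inj-of : ∀ v {σ} → σ ∈ matchings v → Injective _≡_ _≡_ (lookup σ)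
    inj-of v {σ} σ∈ = proj₁ (isPM⁻ E σ (proj₁ (∧⁻ (proj₂ (∈-filter⁻ (T? ∘ isPMe E u v) {xs = allVecs n n} σ∈)))))
    forwards backwards : Vec (Fin n) n → ℕ
    forwards σ = length (filterᵇ (λ p → forward (σ , p)) (pairs n))
    backwards σ = numWalks E (lookup σ) (preimage (lookup σ) w) w′
    lower : ∀ σ → Injective _≡_ _≡_ (lookup σ) →
      (d - ℕ→ℚ 4 * ε) * N²d² ≤ ℕ→ℚ (forwards σ)
    -- The colliding walks, at most `5 n`, are added on both sides, since `cube-minus-5N` is stated
    -- in that form.
    lower σ inj = +-cancelʳ-≤ (ℕ→ℚ 5 * N) (begin
      (d - ℕ→ℚ 4 * ε) * N²d² + ℕ→ℚ 5 * N                      ≤⟨ cube-minus-5N 0<d d≤1 0<ε ε≤ 0<N 1≤νn ⟩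
      (d - ε) * ((d * N - ε * N) * (d * N - ε * N))           ≤⟨ numWalks-lower inj (pivot σ) w ⟩
      ℕ→ℚ (numWalks E (lookup σ) (pivot σ) w)                 ≤⟨ ℕ→ℚ-mono-≤ (numWalks E (lookup σ) (pivot σ) w) (forwards σ ℕ.+ 5 ℕ.* n) (ℕₚ.≤-trans
        (length-filter-∖ (walk E (lookup σ) (pivot σ) w) (collides u (pivot σ)) (pairs n))
        (ℕₚ.+-monoʳ-≤ (forwards σ) (numCollisions u (pivot σ)))) ⟩
      ℕ→ℚ (forwards σ ℕ.+ 5 ℕ.* n)
        ≡⟨ trans (ℕ→ℚ-+ (forwards σ) (5 ℕ.* n)) (cong (λ k → ℕ→ℚ (forwards σ) + k) (ℕ→ℚ-* 5 n)) ⟩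
      ℕ→ℚ (forwards σ) + ℕ→ℚ 5 * N ∎)

  -- Summing `numPMe-ratio` over the neighbours of `u` compares the number of all matchings with
  -- `degU E u` copies of the share of u w. The rational `δ` ranges over upper bounds of the
  -- possibly irrational 20th root of `ε`.
  numPMe-≐ : ∀ {w} → T (E u w) → ∀ {δ} → 0ℚ ≤ δ → ε ≤ δ ^ 20 →
    ℕ→ℚ (numPMe E u w) * d * N ≐ ℕ→ℚ (numPM E) ± (δ * ℕ→ℚ (numPM E))
  numPMe-≐ {w} uw {δ} 0≤δ ε≤δ²⁰ =
      edge-share-lower 0<d d≤1 0<ε ε≤ 0<N {δ} {Mₑ} {M} {D} 0≤δ 24ε≤ (0≤ℕ→ℚ (numPMe E u w)) (0≤ℕ→ℚ (numPM E)) total-upper (proj₂ (degU-≐ u))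
    , edge-share-upper 0<d d≤1 0<ε ε≤ 0<N {δ} {Mₑ} {M} {D} 0≤δ 24ε≤ (0≤ℕ→ℚ (numPMe E u w)) (0≤ℕ→ℚ (numPM E)) total-lower (proj₁ (degU-≐ u))
    where
    24ε≤ = 24ε≤δd 0<d d≤1 0<ε ε≤ 0≤δ ε≤δ²⁰
    Mₑ = ℕ→ℚ (numPMe E u w)
    M = ℕ→ℚ (numPM E)
    D = ℕ→ℚ (degU E u)
    nbrs = filterᵇ (E u) (allFin n)
    nbr : ∀ {w′} → w′ ∈ nbrs → T (E u w′)
    nbr w′∈ = proj₂ (∈-filter⁻ (T? ∘ E u) {xs = allFin n} w′∈)
    total-lower : Mₑ * (d - ℕ→ℚ 4 * ε) * ℕ→ℚ (degU E u) ≤ (d + ℕ→ℚ 7 * ε) * ℕ→ℚ (numPM E)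
    total-lower =
      sum-lower (numPMe E u) (Mₑ * (d - ℕ→ℚ 4 * ε)) (d + ℕ→ℚ 7 * ε) nbrs (degU E u) (numPM E) refl (sym (numPM-split E u)) λ w′ w′∈ →
        ≤-trans (numPMe-ratio w w′ (w ≟ w′) (nbr w′∈)) (≤-reflexive (*-comm (ℕ→ℚ (numPMe E u w′)) (d + ℕ→ℚ 7 * ε)))
    total-upper : (d - ℕ→ℚ 4 * ε) * ℕ→ℚ (numPM E) ≤ Mₑ * (d + ℕ→ℚ 7 * ε) * ℕ→ℚ (degU E u)
    -- The ratio is used with the roles of `w` and `w′` exchanged, switching into u w; this is where
    -- u w has to be an edge.
    total-upper =
      sum-upper (numPMe E u) (Mₑ * (d + ℕ→ℚ 7 * ε)) (d - ℕ→ℚ 4 * ε) nbrs (degU E u) (numPM E) refl (sym (numPM-split E u)) λ w′ w′∈ →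
        ≤-trans (≤-reflexive (*-comm (d - ℕ→ℚ 4 * ε) (ℕ→ℚ (numPMe E u w′)))) (numPMe-ratio w′ w (w′ ≟ w) uw)

theorem4p3 : Σ (ℚ → ℚ) λ ε₀ → Σ (ℚ → ℚ → ℚ) λ ν₀ →
    Mono₁ ε₀ × Mono₂ ν₀
    × (∀ d → 0ℚ < d → 0ℚ < ε₀ d)
    × (∀ ε d → 0ℚ < ε → 0ℚ < d → 0ℚ < ν₀ ε d)
    × ((d ε : ℚ) (n : ℕ) →
    0ℚ < d → d ≤ 1ℚ → 0ℚ < ε → ε ≤ ε₀ d →
    ℕ→ℚ 1 ≤ ν₀ ε d * ℕ→ℚ n →
    (E : BipGraph n) → SuperRegular ε d E →
    (u w : Fin n) → E u w ≡ true →
    (0 Data.Nat.< numPM E)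
    × ((δ : ℚ) → 0ℚ ≤ δ → ε ≤ δ ^ 20 →
    ℕ→ℚ (numPMe E u w) * d * ℕ→ℚ n ≐ ℕ→ℚ (numPM E) ± (δ * ℕ→ℚ (numPM E))))
theorem4p3 = ε-bound , ν-bound , ε-bound-mono , ν-bound-mono , ε-bound-pos , ν-bound-pos ,
  λ d ε n 0<d d≤1 0<ε ε≤ 1≤νn E sr u w uw →
    let open EdgeShare 0<d d≤1 0<ε ε≤ 1≤νn E sr u
    in numPM-pos , λ δ 0≤δ ε≤δ²⁰ → numPMe-≐ (Equivalence.from T-≡ uw) 0≤δ ε≤δ²⁰
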